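{- There exists a string family on which $\ell = \Omega(z_e\log n/\log\log n)$. That is, there is an infinite set $\mathcal{F}$ of strings such that $\ell(w)=\Omega\big(z_e(w)\log n/\log\log n\big)$ for $w\in\mathcal{F}$, where $n=|w|$.
   Context: A string family is an infinite set of finite strings of unbounded length; asymptotic notation on a family refers to strings $w$ of the family with $n=|w|\to\infty$ (with constants uniform over the family). $w[i:j]$ denotes the substring of $w$ from position $i$ to position $j$ (positions start at 1). L-systems: an L-system is a tuple $(\Sigma,\varphi,\tau,s,d,n)$, where $\Sigma$ is a finite alphabet, $\varphi:\Sigma^*\to\Sigma^*$ is a non-erasing monoid endomorphism (each rule $a\to\varphi(a)$, $a\in\Sigma$, has $|\varphi(a)|\ge 1$), $\tau:\Sigma^*\to\Sigma^*$ is a coding (a morphism with $|\tau(a)|=1$ for all $a\in\Sigma$), $s\in\Sigma^+$ is the axiom, and $d\ge 0$, $n\ge 1$ are integers. It generates the unique string $\tau(\varphi^d(s))[1:n]$ of length $n$. It is always assumed that $d=n^{O(1)}$ and $|\Sigma|=n^{O(1)}$ (each value fits in an $O(\log n)$-bit word). The size of the L-system is $\sum_{a\in\Sigma}|\varphi(a)|+|s|+|\Sigma|+2$. The measure $\ell(w)$ is the size of the smallest L-system generating $w$. LZ-End: the LZ-End parsing factorizes $w=w_1w_2\cdots w_k$ into non-empty phrases from left to right. Once $w_1,\dots,w_{i-1}$ have been produced, $w_i$ is the longest non-empty prefix of the remaining suffix of $w$ that has an occurrence inside $w_1\cdots w_{i-1}$ ending at the end of some previous phrase (i.e. it is a suffix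 of $w_1\cdots w_j$ for some $j<i$); if there is no such prefix, $w_i$ is the next single symbol. $z_e(w)$ is the number $k$ of phrases. -}

module Defs where

open import Level using (0ℓ)
open import Data.Bool.Base using (if_then_else_)
open import Data.Nat.Base using (ℕ; zero; suc; _+_; _^_; _≤_)
open import Data.Nat.Properties using (_≟_)
open import Data.Nat.GeneralisedArithmetic using (iterate)
open import Data.Fin.Base using (Fin)
open import Data.List.Base
  using (List; []; _∷_; _∷ʳ_; length; map; concat; concatMap; take; drop; inits; tabulate)
open import Data.Nat.ListAction using (sum)
open import Data.List.Relation.Unary.Any using (Any; any?)
open import Data.List.Relation.Binary.Suffix.Heterogeneous using (Suffix)
open import Data.List.Relation.Binary.Suffix.Heterogeneous.Properties using (suffix?)
open import Data.Product.Base using (∃; _×_)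
open import Function.Bundles using (_↣_; Injection)
open import Relation.Binary.PropositionalEquality.Core using (_≡_)
open import Relation.Nullary.Decidable.Core using (Dec; does)
open import Relation.Unary using (Pred; _∈_)

-- ℕ is a countable supply of symbols; every string uses finitely many of them.
Str : Set
Str = List ℕ

Unbounded : Pred Str 0ℓ → Set
Unbounded F = ∀ k → ∃ λ w → w ∈ F × k ≤ length w

-- The alphabet Σ is an arbitrary finite set of symbols, presented by an
-- injective enumeration of its |Σ| = σ elements.  The morphisms φ and τ are
-- given by their values on single letters.
record LSystem : Set where
  field
    σ          : ℕ
    symbol     : Fin σ ↣ ℕ
    φ          : Fin σ → List (Fin σ)
    nonErasing : ∀ a → 1 ≤ length (φ a)
    τ          : Fin σ → Fin σ
    axiom      : List (Fin σ)
    nonEmpty   : 1 ≤ length axiom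
    d          : ℕ
    n          : ℕ
    n≥1        : 1 ≤ n

  size : ℕ
  size = sum (tabulate (λ a → length (φ a))) + length axiom + σ + 2

  output : Str
  output = map (Injection.to symbol)
               (take n (map τ (iterate (concatMap φ) axiom d)))

-- The length condition excludes systems for which τ(φᵈ(s)) has fewer than n
-- letters, so that τ(φᵈ(s))[1:n] is not defined.
Generates : LSystem → Str → Set
Generates G w = LSystem.output G ≡ w × length w ≡ LSystem.n G

-- The standing assumption d = n^O(1), |Σ| = n^O(1), with exponent c.
PolyBounded : ℕ → LSystem → Set
PolyBounded c G = d ≤ n ^ c × σ ≤ n ^ c
  where open LSystem G

-- ℓ(w) = m, the L-systems being those with d and |Σ| at most n ^ c.
record Isℓ (c : ℕ) (w : Str) (m : ℕ) : Set where
  field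
    attained : ∃ λ G → PolyBounded c G × Generates G w × LSystem.size G ≡ m
    minimal  : ∀ G → PolyBounded c G → Generates G w → m ≤ LSystem.size G

-- x is a suffix of w₁⋯wⱼ for some j, where ps = w₁, …, wᵢ₋₁.  The case j = 0
-- is harmless, as only non-empty x are tested below.
EndsAtPhrase : List Str → Str → Set
EndsAtPhrase ps x = Any (λ qs → Suffix _≡_ x (concat qs)) (inits ps)

endsAtPhrase? : ∀ ps x → Dec (EndsAtPhrase ps x)
endsAtPhrase? ps x = any? (λ qs → suffix? _≟_ x (concat qs)) (inits ps)

-- The largest k with 1 ≤ k ≤ b such that the first k letters of the remaining
-- string r satisfy EndsAtPhrase ps, or 1 if there is none.
phraseLength : List Str → Str → (b : ℕ) → ℕ
phraseLength ps r zero    = 1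
phraseLength ps r (suc b) =
  if does (endsAtPhrase? ps (take (suc b) r)) then suc b else phraseLength ps r b

-- The first argument bounds the number of further phrases; since phrases are
-- non-empty, the length of the remaining string is enough.
lzEndFrom : ℕ → List Str → Str → List Str
lzEndFrom zero    ps r         = ps
lzEndFrom (suc b) ps []        = ps
lzEndFrom (suc b) ps r@(_ ∷ _) = lzEndFrom b (ps ∷ʳ take k r) (drop k r)
  where k = phraseLength ps r (length r)

lzEnd : Str → List Str
lzEnd w = lzEndFrom (length w) [] w

zₑ : Str → ℕ
zₑ w = length (lzEnd w)

{-# OPTIONS --safe #-}

-- Words of the form 0^(2^p) 0^k₁ 1 ⋯ 0^kₚ 1 with all kᵢ < 2^p have length
-- n = 2^Θ(p) and at most 3p + 1 LZ-End phrases: the parse of the zeros doubles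
-- its length with each phrase, after which a phrase never ends strictly inside
-- the block 0^kᵢ or 1 in which it starts.  There are 2^(p²) such words, while an
-- L-system of size s is described by O(s) tokens of O(log s) bits together with
-- d and n, which cost only O(p) bits.  So for s below a constant times p² / log p
-- the L-systems are too few, and by the pigeonhole principle some word of each
-- order p has ℓ = Ω(p² / log p).

module Submission where

open import Defs
open import Level using (0ℓ)
open import Data.Bool.Base using (if_then_else_)
open import Data.Fin.Base using (Fin; zero; suc; toℕ; fromℕ<; combine; remQuot; finToFun; funToFin)
import Data.Fin.Properties as Fin
open import Data.List.Base
  using (List; []; _∷_; [_]; _∷ʳ_; _++_; length; map; concat; concatMap; take; drop; inits; tabulate; replicate)
open import Data.List.Properties
open import Data.List.Relation.Binary.Pointwise using (≡⇒Pointwise-≡)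
open import Data.List.Relation.Binary.Suffix.Heterogeneous using (Suffix)
open import Data.List.Relation.Binary.Suffix.Heterogeneous.Properties
  using (length-mono; fromPointwise; replicate⁺)
open import Data.List.Relation.Unary.All as All using (All; []; _∷_)
import Data.List.Relation.Unary.All.Properties as All
open import Data.List.Relation.Unary.Any using (Any; here; there)
import Data.List.Relation.Unary.Any.Properties as Any
open import Data.Nat.Base
  using (ℕ; zero; suc; _+_; _*_; _^_; _∸_; _⊓_; _≤_; _<_; z≤n; s≤s; NonZero; >-nonZero; >-nonZero⁻¹)
open import Data.Nat.DivMod using (_/_; _%_; m/n*n≤m; m/n<m; m≡m%n+[m/n]*n; m%n<n)
open import Data.Nat.GeneralisedArithmetic using (iterate)
open import Data.Nat.ListAction using (sum)
open import Data.Nat.Logarithm using (⌊log₂_⌋; ⌊log₂⌋-mono-≤; ⌊log₂[2^n]⌋≡n)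
open import Data.Nat.Properties
open import Data.Nat.Tactic.RingSolver using (solve-∀)
open import Data.Product.Base using (∃; _×_; _,_; proj₁; proj₂; map₂)
open import Data.Sum.Base using (_⊎_; inj₁; inj₂)
open import Function.Base using (_∘_; id)
open import Function.Bundles using (Injection)
open import Relation.Binary.PropositionalEquality
  using (_≡_; _≢_; refl; sym; trans; cong; cong₂; subst; subst₂; module ≡-Reasoning)
open import Relation.Nullary using (Dec; does; yes; no; ¬_; contradiction)
open import Relation.Unary using (Pred; _∈_)

private
  variable
    A : Set

-- Bounds on the length of an LZ-End phrase.

Any-inits⁺ : ∀ (P : List A → Set) xs ys → P xs → Any P (inits (xs ++ ys))
Any-inits⁺ P []       ys p = here p
Any-inits⁺ P (x ∷ xs) ys p = there (Any.map⁺ (Any-inits⁺ (P ∘ (x ∷_)) xs ys p))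

Any-inits⁻ : ∀ (P : List A → Set) zs → Any P (inits zs) → ∃ λ xs → ∃ λ ys → zs ≡ xs ++ ys × P xs
Any-inits⁻ P zs       (here p)  = [] , zs , refl , p
Any-inits⁻ P (z ∷ zs) (there p) with Any-inits⁻ (P ∘ (z ∷_)) zs (Any.map⁻ p)
... | xs , ys , eq , q = z ∷ xs , ys , cong (z ∷_) eq , q

endsAtPhrase-length : ∀ ps x → EndsAtPhrase ps x → length x ≤ length (concat ps)
endsAtPhrase-length ps x e with Any-inits⁻ _ ps e
... | qs , rs , refl , s = begin
  length x                             ≤⟨ length-mono s ⟩
  length (concat qs)                   ≤⟨ length-++-≤ˡ (concat qs) ⟩
  length (concat qs ++ concat rs)      ≡⟨ cong length (concat-++ qs rs) ⟩
  length (concat (qs ++ rs))           ∎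
  where open ≤-Reasoning

-- phraseLength normalises past endsAtPhrase?, so a with-abstraction cannot split it.
if-dec : ∀ {P : Set} (p? : Dec P) (x y : A) →
         P × (if does p? then x else y) ≡ x ⊎ ¬ P × (if does p? then x else y) ≡ y
if-dec (yes p) x y = inj₁ (p , refl)
if-dec (no ¬p) x y = inj₂ (¬p , refl)

phraseLength-suc : ∀ ps r b →
                   EndsAtPhrase ps (take (suc b) r) × phraseLength ps r (suc b) ≡ suc b ⊎
                   ¬ EndsAtPhrase ps (take (suc b) r) × phraseLength ps r (suc b) ≡ phraseLength ps r b
phraseLength-suc ps r b = if-dec (endsAtPhrase? ps (take (suc b) r)) _ _

-- The search descends from `b`, so an admissible `k` is passed over only for a longer prefix; the
-- default value 1 covers `k ≤ 1`.
phraseLength-lower : ∀ ps r b k → k ≤ b → k ≤ 1 ⊎ EndsAtPhrase ps (take k r) → k ≤ phraseLength ps r b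
phraseLength-lower ps r zero    k k≤b _ = ≤-trans k≤b z≤n
phraseLength-lower ps r (suc b) k k≤b h with phraseLength-suc ps r b
... | inj₁ (_ , eq)  = subst (k ≤_) (sym eq) k≤b
... | inj₂ (¬e , eq) = subst (k ≤_) (sym eq) (longer (m≤n⇒m<n∨m≡n k≤b) h)
  where
  longer : k < suc b ⊎ k ≡ suc b → k ≤ 1 ⊎ EndsAtPhrase ps (take k r) → k ≤ phraseLength ps r b
  longer (inj₁ k<sb) h               = phraseLength-lower ps r b k (≤-pred k<sb) h
  longer (inj₂ refl) (inj₁ (s≤s z≤n)) = ≤-refl
  longer (inj₂ refl) (inj₂ e)        = contradiction e ¬e

phraseLength-upper : ∀ ps r b m → 1 ≤ m →
                     (∀ k → k ≤ b → EndsAtPhrase ps (take k r) → k ≤ m) → phraseLength ps r b ≤ m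
phraseLength-upper ps r zero    m 1≤m h = 1≤m
phraseLength-upper ps r (suc b) m 1≤m h with phraseLength-suc ps r b
... | inj₁ (e , eq) = subst (_≤ m) (sym eq) (h (suc b) ≤-refl e)
... | inj₂ (_ , eq) = subst (_≤ m) (sym eq) (phraseLength-upper ps r b m 1≤m (λ k k≤b → h k (m≤n⇒m≤1+n k≤b)))

-- The source of a phrase lies inside the parsed part and cannot overlap the phrase. The hypothesis
-- accounts for the default value 1.
phraseLength≤ : ∀ ps r → 1 ≤ length (concat ps) → phraseLength ps r (length r) ≤ length (concat ps)
phraseLength≤ ps r 1≤ = phraseLength-upper ps r (length r) _ 1≤ λ k k≤r e →
  subst (_≤ length (concat ps)) (trans (length-take k r) (m≤n⇒m⊓n≡m k≤r)) (endsAtPhrase-length ps _ e)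

-- Charging phrases to blocks.

take-++-length : ∀ (xs ys : List A) → take (length xs) (xs ++ ys) ≡ xs
take-++-length []       ys = refl
take-++-length (x ∷ xs) ys = cong (x ∷_) (take-++-length xs ys)

drop-++ : ∀ n (xs ys : List A) → drop n (xs ++ ys) ≡ drop n xs ++ drop (n ∸ length xs) ys
drop-++ zero    []       ys = refl
drop-++ zero    (x ∷ xs) ys = refl
drop-++ (suc n) []       ys = refl
drop-++ (suc n) (x ∷ xs) ys = drop-++ n xs ys

-- Every tail of a block can start the next phrase once u ends at a phrase
-- boundary; single letters always can.
Block : Str → Str → Set
Block u b = ∀ t → length (drop t b) ≤ 1 ⊎ Suffix _≡_ (drop t b) u

-- Used-up blocks remain as empty lists, so the number of blocks, to which phrases are charged, does
-- not change.
dropBlocks : ℕ → List Str → List Str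
dropBlocks t []       = []
dropBlocks t (b ∷ bs) = drop t b ∷ dropBlocks (t ∸ length b) bs

concat-dropBlocks : ∀ t bs → concat (dropBlocks t bs) ≡ drop t (concat bs)
concat-dropBlocks zero    []       = refl
concat-dropBlocks (suc t) []       = refl
concat-dropBlocks t       (b ∷ bs) =
  trans (cong (drop t b ++_) (concat-dropBlocks (t ∸ length b) bs)) (sym (drop-++ t b (concat bs)))

length-dropBlocks : ∀ t bs → length (dropBlocks t bs) ≡ length bs
length-dropBlocks t []       = refl
length-dropBlocks t (b ∷ bs) = cong suc (length-dropBlocks (t ∸ length b) bs)

-- `Block` speaks of all tails, so it passes to the remainder of a block that a phrase leaves
-- unfinished.
block-dropBlocks : ∀ {u} t bs → All (Block u) bs → All (Block u) (dropBlocks t bs)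
block-dropBlocks t []       []         = []
block-dropBlocks {u} t (b ∷ bs) (g ∷ gs) =
  (λ s → subst (λ x → length x ≤ 1 ⊎ Suffix _≡_ x u) (sym (drop-drop t s b)) (g (t + s)))
  ∷ block-dropBlocks (t ∸ length b) bs gs

-- A phrase reaches at least the end of the block in which it starts, so it can be
-- charged to that block.
lzEndFrom-blocks : ∀ f qs rs bs → All (Block (concat qs)) bs →
                   length (lzEndFrom f (qs ++ rs) (concat bs)) ≤ length (qs ++ rs) + length bs
lzEndFrom-blocks zero    qs rs bs _ = m≤m+n _ _
lzEndFrom-blocks (suc f) qs rs [] _ = m≤m+n _ _
-- A used-up block costs neither a phrase nor fuel.
lzEndFrom-blocks (suc f) qs rs ([] ∷ bs) (_ ∷ gs) =
  ≤-trans (lzEndFrom-blocks (suc f) qs rs bs gs) (+-monoʳ-≤ (length (qs ++ rs)) (n≤1+n _))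
lzEndFrom-blocks (suc f) qs rs (b@(x ∷ b') ∷ bs) (g ∷ gs) = begin
  length (lzEndFrom f ((qs ++ rs) ∷ʳ p) (drop k r))
    ≡⟨ cong₂ (λ y z → length (lzEndFrom f y z)) (++-assoc qs rs [ p ]) rest ⟩
  length (lzEndFrom f (qs ++ rs ∷ʳ p) (concat bs'))
    -- The new phrase joins `rs`; `qs`, to which the block property refers, stays fixed.
    ≤⟨ lzEndFrom-blocks f qs (rs ∷ʳ p) bs' (block-dropBlocks _ bs gs) ⟩
  length (qs ++ rs ∷ʳ p) + length bs'
    ≡⟨ cong₂ _+_ (cong length (sym (++-assoc qs rs [ p ]))) (length-dropBlocks _ bs) ⟩
  length ((qs ++ rs) ∷ʳ p) + length bs
    ≡⟨ cong (_+ length bs) (trans (length-++ (qs ++ rs)) (+-comm _ 1)) ⟩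
  suc (length (qs ++ rs)) + length bs
    ≡⟨ sym (+-suc _ _) ⟩
  length (qs ++ rs) + suc (length bs)                 ∎
  where
  open ≤-Reasoning
  r   = b ++ concat bs
  k   = phraseLength (qs ++ rs) r (length r)
  p   = take k r
  bs' = dropBlocks (k ∸ length b) bs
  avail : length b ≤ 1 ⊎ EndsAtPhrase (qs ++ rs) (take (length b) r)
  avail with g 0
  ... | inj₁ l = inj₁ l
  ... | inj₂ s = inj₂ (Any-inits⁺ _ qs rs
    (subst (λ y → Suffix _≡_ y (concat qs)) (sym (take-++-length b (concat bs))) s))
  b≤k : length b ≤ k
  b≤k = phraseLength-lower (qs ++ rs) r (length r) (length b) (length-++-≤ˡ b) avail
  rest : drop k r ≡ concat bs'
  rest = trans (drop-++ k b (concat bs))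
           (trans (cong (_++ drop (k ∸ length b) (concat bs)) (drop-all k b b≤k)) (sym (concat-dropBlocks _ bs)))

-- Doubling phrases on a run of zeros.

replicate-++ : ∀ m n → replicate m 0 ++ replicate n 0 ≡ replicate (m + n) 0
replicate-++ zero    n = refl
replicate-++ (suc m) n = cong (0 ∷_) (replicate-++ m n)

-- Zeros in `j` pieces of lengths l, 2l, 4l, ..., cut where the phrases will end.
run : ℕ → ℕ → Str
run zero    l = []
run (suc j) l = replicate l 0 ++ run j (l + l)

-- While the parsed part is 0^l and at least l zeros remain, the next phrase is
-- exactly 0^l: a longer one would not fit into the parsed part.
lzEndFrom-run : ∀ j l f ps bs → 1 ≤ l → concat ps ≡ replicate l 0 →
                All (Block (replicate l 0 ++ run j l)) bs →
                length (lzEndFrom f ps (run j l ++ concat bs)) ≤ length ps + (j + length bs)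
lzEndFrom-run zero l f ps bs 1≤l eq gs =
  subst (λ qs → length (lzEndFrom f qs (concat bs)) ≤ length qs + length bs) (++-identityʳ ps)
    (lzEndFrom-blocks f ps [] bs (subst (λ u → All (Block u) bs) (trans (++-identityʳ _) (sym eq)) gs))
lzEndFrom-run (suc j) l zero ps bs 1≤l eq gs = m≤m+n _ _
lzEndFrom-run (suc j) l@(suc l') (suc f) ps bs 1≤l eq gs = begin
  length (lzEndFrom f (ps ∷ʳ take k r) (drop k r))
    ≡⟨ cong₂ (λ y z → length (lzEndFrom f (ps ∷ʳ y) z)) take≡ drop≡ ⟩
  length (lzEndFrom f (ps ∷ʳ a) (run j (l + l) ++ concat bs))
    ≤⟨ lzEndFrom-run j (l + l) f (ps ∷ʳ a) bs (s≤s z≤n) eq' (subst (λ u → All (Block u) bs) shift gs) ⟩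
  length (ps ∷ʳ a) + (j + length bs)
    ≡⟨ cong (_+ (j + length bs)) (trans (length-++ ps) (+-comm _ 1)) ⟩
  suc (length ps) + (j + length bs)
    ≡⟨ sym (+-suc _ _) ⟩
  length ps + suc (j + length bs) ∎
  where
  open ≤-Reasoning
  a = replicate l 0
  r = (a ++ run j (l + l)) ++ concat bs
  k = phraseLength ps r (length r)
  y = run j (l + l) ++ concat bs
  r≡ : r ≡ a ++ y
  r≡ = ++-assoc a (run j (l + l)) (concat bs)
  take-l : take (length a) r ≡ a
  take-l = trans (cong (take (length a)) r≡) (take-++-length a y)
  |ps| : length (concat ps) ≡ length a
  |ps| = cong length eq
  k≡ : k ≡ length a
  k≡ = ≤-antisym
    (subst (k ≤_) |ps| (phraseLength≤ ps r (subst (1 ≤_) (sym |ps|) (s≤s z≤n))))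
    -- The whole parsed part is itself a candidate, since it ends at the last phrase boundary.
    (phraseLength-lower ps r (length r) (length a)
      (subst (λ z → length a ≤ length z) (sym r≡) (length-++-≤ˡ a))
      (inj₂ (subst (λ qs → EndsAtPhrase qs (take (length a) r)) (++-identityʳ ps)
        (Any-inits⁺ _ ps [] (fromPointwise (≡⇒Pointwise-≡ (trans take-l (sym eq))))))))
  take≡ : take k r ≡ a
  take≡ = trans (cong (λ z → take z r) k≡) take-l
  drop≡ : drop k r ≡ y
  drop≡ = trans (cong₂ drop k≡ r≡) (trans (drop-++ (length a) a y)
            (cong₂ _++_ (drop-all (length a) a ≤-refl) (cong (λ z → drop z y) (n∸n≡0 (length a)))))
  aa : a ++ a ≡ replicate (l + l) 0
  aa = replicate-++ l l
  eq' : concat (ps ∷ʳ a) ≡ replicate (l + l) 0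
  eq' = trans (sym (concat-++ ps [ a ])) (trans (cong₂ _++_ eq (++-identityʳ a)) aa)
  -- The zeros up to the end of the run are the same before and after the step, so the block
  -- hypothesis carries over.
  shift : a ++ (a ++ run j (l + l)) ≡ replicate (l + l) 0 ++ run j (l + l)
  shift = trans (sym (++-assoc a a _)) (cong (_++ run j (l + l)) aa)

-- The candidate words: phrase count, length, injectivity.

blocks : List ℕ → List Str
blocks []       = []
blocks (k ∷ ks) = replicate k 0 ∷ [ 1 ] ∷ blocks ks

-- The leading 0 is the first phrase; with `run p 1` it makes 2^p zeros.
word : ℕ → List ℕ → Str
word p ks = 0 ∷ (run p 1 ++ concat (blocks ks))

prefix-run : ∀ j l → replicate l 0 ++ run j l ≡ replicate (l * 2 ^ j) 0
prefix-run zero    l = trans (++-identityʳ _) (cong (λ m → replicate m 0) (sym (*-identityʳ l)))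
prefix-run (suc j) l = begin
  replicate l 0 ++ (replicate l 0 ++ run j (l + l)) ≡⟨ sym (++-assoc (replicate l 0) _ _) ⟩
  (replicate l 0 ++ replicate l 0) ++ run j (l + l) ≡⟨ cong (_++ run j (l + l)) (replicate-++ l l) ⟩
  replicate (l + l) 0 ++ run j (l + l)              ≡⟨ prefix-run j (l + l) ⟩
  replicate ((l + l) * 2 ^ j) 0                     ≡⟨ cong (λ m → replicate m 0) (double l (2 ^ j)) ⟩
  replicate (l * 2 ^ suc j) 0                       ∎
  where
  open ≡-Reasoning
  double : ∀ x y → (x + x) * y ≡ x * (2 * y)
  double = solve-∀

drop-replicate : ∀ t k → drop t (replicate k 0) ≡ replicate (k ∸ t) 0
drop-replicate zero    k       = refl
drop-replicate (suc t) zero    = refl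
drop-replicate (suc t) (suc k) = drop-replicate t k

-- Tails of 0^k are runs of at most m zeros, hence suffixes of 0^m; the block 1 uses the
-- single-letter alternative.
block-blocks : ∀ m ks → All (_≤ m) ks → All (Block (replicate m 0)) (blocks ks)
block-blocks m []       []        = []
block-blocks m (k ∷ ks) (k≤ ∷ h) =
  (λ t → inj₂ (subst (λ x → Suffix _≡_ x (replicate m 0)) (sym (drop-replicate t k))
                 (replicate⁺ (≤-trans (m∸n≤m k t) k≤) refl)))
  ∷ (λ { zero → inj₁ ≤-refl ; (suc zero) → inj₁ z≤n ; (suc (suc _)) → inj₁ z≤n })
  ∷ block-blocks m ks h

length-blocks : ∀ ks → length (blocks ks) ≡ 2 * length ks
length-blocks []       = refl
length-blocks (k ∷ ks) = trans (cong (λ n → suc (suc n)) (length-blocks ks)) (sym (*-suc 2 (length ks)))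

-- One phrase for the first letter, at most `p` doublings, and at most one phrase for each of the
-- two blocks of a number.
zₑ-word : ∀ p ks → All (_≤ 2 ^ p) ks → zₑ (word p ks) ≤ 1 + (p + 2 * length ks)
zₑ-word p ks h = begin
  length (lzEndFrom (length r) ([ take k w ]) (drop k w))
    ≡⟨ cong (λ k → length (lzEndFrom (length r) ([ take k w ]) (drop k w))) k≡1 ⟩
  length (lzEndFrom (length r) ([ [ 0 ] ]) r)
    ≤⟨ lzEndFrom-run p 1 (length r) ([ [ 0 ] ]) (blocks ks) ≤-refl refl
         (subst (λ u → All (Block u) (blocks ks))
           (sym (trans (prefix-run p 1) (cong (λ m → replicate m 0) (*-identityˡ (2 ^ p)))))
           (block-blocks (2 ^ p) ks h)) ⟩
  1 + (p + length (blocks ks))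
    ≡⟨ cong (λ n → 1 + (p + n)) (length-blocks ks) ⟩
  1 + (p + 2 * length ks) ∎
  where
  open ≤-Reasoning
  r = run p 1 ++ concat (blocks ks)
  w = word p ks
  k = phraseLength [] w (length w)
  k≡1 : k ≡ 1
  -- Nothing is parsed yet, so no non-empty prefix passes the test and the default value 1 applies.
  k≡1 = ≤-antisym
    (phraseLength-upper [] w (length w) 1 ≤-refl λ j j≤ e →
      ≤-trans (subst (_≤ 0) (trans (length-take j w) (m≤n⇒m⊓n≡m j≤)) (endsAtPhrase-length [] _ e)) z≤n)
    (phraseLength-lower [] w (length w) 1 (s≤s z≤n) (inj₁ ≤-refl))

word≡ : ∀ p ks → word p ks ≡ replicate (2 ^ p) 0 ++ concat (blocks ks)
word≡ p ks = cong (_++ concat (blocks ks))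
  (trans (prefix-run p 1) (cong (λ m → replicate m 0) (*-identityˡ (2 ^ p))))

length-concat-blocks : ∀ m ks → All (_< m) ks → length (concat (blocks ks)) ≤ length ks * m
length-concat-blocks m []       []        = z≤n
length-concat-blocks m (k ∷ ks) (k< ∷ h) = begin
  length (replicate k 0 ++ 1 ∷ concat (blocks ks))        ≡⟨ length-++ (replicate k 0) ⟩
  length (replicate k 0) + suc (length (concat (blocks ks))) ≡⟨ cong (_+ suc (length (concat (blocks ks)))) (length-replicate k) ⟩
  k + suc (length (concat (blocks ks)))                   ≡⟨ +-suc k _ ⟩
  suc k + length (concat (blocks ks))                     ≤⟨ +-mono-≤ k< (length-concat-blocks m ks h) ⟩
  m + length ks * m                                       ∎
  where open ≤-Reasoning

length-word≥ : ∀ p ks → 2 ^ p ≤ length (word p ks)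
length-word≥ p ks =
  subst₂ _≤_ (length-replicate (2 ^ p)) (cong length (sym (word≡ p ks))) (length-++-≤ˡ (replicate (2 ^ p) 0))

length-word≤ : ∀ p ks → All (_< 2 ^ p) ks → length (word p ks) ≤ suc (length ks) * 2 ^ p
length-word≤ p ks h = begin
  length (word p ks)                                            ≡⟨ cong length (word≡ p ks) ⟩
  length (replicate (2 ^ p) 0 ++ concat (blocks ks))            ≡⟨ length-++ (replicate (2 ^ p) 0) ⟩
  length (replicate (2 ^ p) 0) + length (concat (blocks ks))    ≡⟨ cong (_+ length (concat (blocks ks))) (length-replicate (2 ^ p)) ⟩
  2 ^ p + length (concat (blocks ks))                           ≤⟨ +-monoʳ-≤ (2 ^ p) (length-concat-blocks _ ks h) ⟩
  2 ^ p + length ks * 2 ^ p                                     ∎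
  where open ≤-Reasoning

binary-word : ∀ p ks → All (_≤ 1) (word p ks)
binary-word p ks = subst (All (_≤ 1)) (sym (word≡ p ks)) (All.++⁺ (zeros (2 ^ p)) (go ks))
  where
  zeros : ∀ m → All (_≤ 1) (replicate m 0)
  zeros m = All.replicate⁺ m z≤n
  go : ∀ ks → All (_≤ 1) (concat (blocks ks))
  go []       = []
  go (k ∷ ks) = All.++⁺ (zeros k) (≤-refl ∷ go ks)

-- Each number is in unary and closed by a 1; a common leading 0 is stripped as `suc k` passes to
-- `k`.
concat-blocks-injective : ∀ ks ks' → concat (blocks ks) ≡ concat (blocks ks') → ks ≡ ks'
concat-blocks-injective []           []            eq = refl
concat-blocks-injective []           (zero ∷ ks')  ()
concat-blocks-injective []           (suc _ ∷ ks') ()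
concat-blocks-injective (zero ∷ ks)  []            ()
concat-blocks-injective (suc _ ∷ ks) []            ()
concat-blocks-injective (zero ∷ ks)  (zero ∷ ks')  eq = cong (0 ∷_) (concat-blocks-injective ks ks' (∷-injectiveʳ eq))
concat-blocks-injective (suc k ∷ ks) (suc k' ∷ ks') eq
  with refl ← concat-blocks-injective (k ∷ ks) (k' ∷ ks') (∷-injectiveʳ eq) = refl

word-injective : ∀ p ks ks' → word p ks ≡ word p ks' → ks ≡ ks'
word-injective p ks ks' eq = concat-blocks-injective ks ks'
  (++-cancelˡ (run p 1) _ _ (∷-injectiveʳ eq))

-- L-systems as token lists.

-- In a token list, 0 ends a segment and suc x is the letter x.
segment : List ℕ → ℕ → List ℕ
segment []           i       = []
segment (zero ∷ ts)  zero    = []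
segment (suc x ∷ ts) zero    = x ∷ segment ts zero
segment (zero ∷ ts)  (suc i) = segment ts i
segment (suc x ∷ ts) (suc i) = segment ts (suc i)

join : List (List ℕ) → List ℕ → List ℕ
join []       ts = ts
join (r ∷ rs) ts = map suc r ++ 0 ∷ join rs ts

segment-zero : ∀ r ts → segment (map suc r ++ 0 ∷ ts) 0 ≡ r
segment-zero []      ts = refl
segment-zero (x ∷ r) ts = cong (x ∷_) (segment-zero r ts)

segment-suc : ∀ r ts i → segment (map suc r ++ 0 ∷ ts) (suc i) ≡ segment ts i
segment-suc []      ts i = refl
segment-suc (x ∷ r) ts i = segment-suc r ts i

segment-join : ∀ {n} (f : Fin n → List ℕ) ts i → segment (join (tabulate f) ts) (toℕ i) ≡ f i
segment-join f ts zero    = segment-zero (f zero) _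
segment-join f ts (suc i) = trans (segment-suc (f zero) _ (toℕ i)) (segment-join (f ∘ suc) ts i)

-- The default keeps `decode` total on token lists that describe no L-system.
head₀ : List ℕ → ℕ
head₀ []      = 0
head₀ (x ∷ _) = x

-- Segment 0 is the axiom; segment a + 1 is the output letter of a followed by φ(a).
decode : List ℕ → ℕ → ℕ → Str
decode ts d n = map (λ x → head₀ (segment ts (suc x)))
  (take n (iterate (concatMap (λ x → drop 1 (segment ts (suc x)))) (segment ts 0) d))

-- Transfers the derivation from `Fin σ` to the letters of the token list, with `toℕ` as `h`.
iterate-concatMap-map : ∀ {A B : Set} (h : A → B) (f : A → List A) (g : B → List B) →
  (∀ a → g (h a) ≡ map h (f a)) → ∀ d xs →
  iterate (concatMap g) (map h xs) d ≡ map h (iterate (concatMap f) xs d)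
iterate-concatMap-map h f g eq zero    xs = refl
iterate-concatMap-map h f g eq (suc d) xs =
  trans (cong (λ ys → iterate (concatMap g) ys d) step) (iterate-concatMap-map h f g eq d (concatMap f xs))
  where
  step : concatMap g (map h xs) ≡ map h (concatMap f xs)
  step = trans (concatMap-map g h xs) (trans (concatMap-cong eq xs) (sym (map-concatMap h f xs)))

-- The reindexing `h` lets the induction shorten the list of rules while their letters stay in
-- `Fin n`. Each rule costs two tokens besides its right-hand side: the output letter and the
-- terminator.
length-join : ∀ {n} (l : Fin n → ℕ) (f : Fin n → List (Fin n)) {m} (h : Fin m → Fin n) ts →
  length (join (tabulate (λ a → l (h a) ∷ map toℕ (f (h a)))) ts)
    ≡ sum (tabulate (λ a → length (f (h a)))) + (m + m) + length ts
length-join l f {zero}  h ts = refl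
length-join l f {suc m} h ts = begin
  suc (length (map suc (map toℕ y) ++ 0 ∷ js))
    ≡⟨ cong suc (length-++ (map suc (map toℕ y))) ⟩
  suc (length (map suc (map toℕ y)) + suc (length js))
    ≡⟨ cong₂ (λ u v → suc (u + suc v)) (trans (length-map suc (map toℕ y)) (length-map toℕ y))
         (length-join l f (h ∘ suc) ts) ⟩
  suc (length y + suc (s + (m + m) + length ts))
    ≡⟨ shuffle (length y) s m (length ts) ⟩
  length y + s + (suc m + suc m) + length ts ∎
  where
  open ≡-Reasoning
  y  = f (h zero)
  s  = sum (tabulate (λ a → length (f (h (suc a)))))
  js = join (tabulate (λ a → l (h (suc a)) ∷ map toℕ (f (h (suc a))))) ts
  shuffle : ∀ a b c d → suc (a + suc (b + (c + c) + d)) ≡ a + b + (suc c + suc c) + d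
  shuffle = solve-∀

All-join : ∀ {t} rs ts → All (All (λ x → suc x < t)) rs → 0 < t → All (_< t) ts → All (_< t) (join rs ts)
All-join []       ts []       0<t h = h
All-join (r ∷ rs) ts (g ∷ gs) 0<t h = All.++⁺ (All.map⁺ g) (0<t ∷ All-join rs ts gs 0<t h)

tabulate-toℕ : ∀ {t} ts → All (_< t) ts → ∃ λ (f : Fin (length ts) → Fin t) → tabulate (toℕ ∘ f) ≡ ts
tabulate-toℕ []       []       = (λ ()) , refl
tabulate-toℕ (x ∷ ts) (x< ∷ h) with tabulate-toℕ ts h
... | f , eq = (λ { zero → fromℕ< x< ; (suc i) → f i }) , cong₂ _∷_ (Fin.toℕ-fromℕ< x<) eq

-- Numbering of token lists with depth and length.

module _ (t l d n : ℕ) where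

  private
    decodeTriple : Fin (t ^ l) × (Fin d × Fin n) → Str
    decodeTriple (c , i , j) = decode (tabulate (toℕ ∘ finToFun {t} {l} c)) (toℕ i) (toℕ j)

  decodeFin : Fin (t ^ l * (d * n)) → Str
  decodeFin x = decodeTriple (map₂ (remQuot {d} n) (remQuot {t ^ l} (d * n) x))

  -- The code is built with `combine` and `funToFin`, which `remQuot` and `finToFun` undo. A single
  -- `Fin` as index set suits the pigeonhole principle.
  decodeFin-surjective : ∀ ts i j → length ts ≡ l → All (_< t) ts → i < d → j < n →
                         ∃ λ x → decodeFin x ≡ decode ts i j
  decodeFin-surjective ts i j refl h i< j< with tabulate-toℕ ts h
  ... | f , eq = combine (funToFin f) (combine (fromℕ< i<) (fromℕ< j<)) , (begin
    decodeTriple (map₂ (remQuot {d} n) (remQuot {t ^ l} (d * n) (combine (funToFin f) (combine (fromℕ< i<) (fromℕ< j<)))))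
      ≡⟨ cong (decodeTriple ∘ map₂ (remQuot {d} n))
           (Fin.remQuot-combine {t ^ l} {d * n} (funToFin f) (combine (fromℕ< i<) (fromℕ< j<))) ⟩
    decodeTriple (funToFin f , remQuot {d} n (combine (fromℕ< i<) (fromℕ< j<)))
      ≡⟨ cong (λ y → decodeTriple (funToFin f , y)) (Fin.remQuot-combine {d} {n} (fromℕ< i<) (fromℕ< j<)) ⟩
    decode (tabulate (toℕ ∘ finToFun {t} {l} (funToFin f))) (toℕ (fromℕ< i<)) (toℕ (fromℕ< j<))
      ≡⟨ cong₂ (decode (tabulate (toℕ ∘ finToFun {t} {l} (funToFin f)))) (Fin.toℕ-fromℕ< i<) (Fin.toℕ-fromℕ< j<) ⟩
    decode (tabulate (toℕ ∘ finToFun {t} {l} (funToFin f))) i j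
      ≡⟨ cong (λ us → decode us i j) (trans (tabulate-cong (cong toℕ ∘ Fin.finToFun-funToFin f)) eq) ⟩
    decode ts i j ∎)
    where open ≡-Reasoning

-- Every small L-system with binary output has a code.

module _ (G : LSystem) where
  open LSystem G using (σ; symbol; φ; τ; axiom; size; output)

  -- Clipping keeps the tokens small and is harmless for binary outputs.
  label : Fin σ → ℕ
  label a = Injection.to symbol (τ a) ⊓ 1

  rows : List (List ℕ)
  rows = map toℕ axiom ∷ tabulate (λ a → label a ∷ map toℕ (φ a))

  -- Segments are read from the front and end at their own terminators, so the padding `ts` is never
  -- reached.
  decode-rows : ∀ ts → All (_≤ 1) output → decode (join rows ts) (LSystem.d G) (LSystem.n G) ≡ output
  decode-rows ts bin = begin
    map letter (take n (iterate (concatMap rule) (segment js 0) d))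
      ≡⟨ cong (λ s → map letter (take n (iterate (concatMap rule) s d))) (segment-zero (map toℕ axiom) _) ⟩
    map letter (take n (iterate (concatMap rule) (map toℕ axiom) d))
      ≡⟨ cong (map letter ∘ take n) (iterate-concatMap-map toℕ φ rule (λ a → cong (drop 1) (seg a)) d axiom) ⟩
    map letter (take n (map toℕ u))
      ≡⟨ cong (map letter) (take-map n u) ⟩
    map letter (map toℕ (take n u))
      ≡⟨ sym (map-∘ (take n u)) ⟩
    map (λ a → letter (toℕ a)) (take n u)
      ≡⟨ map-cong (λ a → cong head₀ (seg a)) (take n u) ⟩
    map label (take n u)
      ≡⟨ map-∘ (take n u) ⟩
    map (λ a → Injection.to symbol a ⊓ 1) (map τ (take n u))
      ≡⟨ cong (map _) (sym (take-map n u)) ⟩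
    map (λ a → Injection.to symbol a ⊓ 1) (take n (map τ u))
      ≡⟨ map-∘ (take n (map τ u)) ⟩
    map (_⊓ 1) output
      ≡⟨ clip output bin ⟩
    output ∎
    where
    open ≡-Reasoning
    d = LSystem.d G
    n = LSystem.n G
    js = join rows ts
    rule : ℕ → List ℕ
    rule x = drop 1 (segment js (suc x))
    letter : ℕ → ℕ
    letter x = head₀ (segment js (suc x))
    u = iterate (concatMap φ) axiom d
    seg : ∀ a → segment js (suc (toℕ a)) ≡ label a ∷ map toℕ (φ a)
    seg a = trans (segment-suc (map toℕ axiom) _ (toℕ a)) (segment-join (λ a → label a ∷ map toℕ (φ a)) ts a)
    clip : ∀ w → All (_≤ 1) w → map (_⊓ 1) w ≡ w
    clip []      []       = refl
    clip (x ∷ w) (h ∷ hs) = cong₂ _∷_ (m≤n⇒m⊓n≡m h) (clip w hs)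

  rows-bound : ∀ {b} → size ≤ b → All (All (λ x → suc x < suc b)) rows
  rows-bound {b} s≤b =
    letters axiom ∷ All.tabulate⁺ (λ a →
      -- A label is at most 1, so its token is at most 2, which the summand 2 of `size` provides.
      s≤s (≤-trans (s≤s (m⊓n≤n _ 1)) (≤-trans (m≤n+m 2 _) s≤b)) ∷ letters (φ a))
    where
    σ≤b : σ ≤ b
    σ≤b = ≤-trans (≤-trans (m≤n+m σ _) (m≤m+n _ 2)) s≤b
    letters : ∀ xs → All (λ x → suc x < suc b) (map toℕ xs)
    letters []       = []
    letters (x ∷ xs) = s≤s (≤-trans (Fin.toℕ<n x) σ≤b) ∷ letters xs

  length-rows : ∀ ts → length (join rows ts) ≡
                length axiom + suc (sum (tabulate (λ a → length (φ a))) + (σ + σ) + length ts)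
  length-rows ts = trans (length-++ (map suc (map toℕ axiom)))
    (cong₂ _+_ (trans (length-map suc (map toℕ axiom)) (length-map toℕ axiom)) (cong suc (length-join label φ id ts)))

  -- Padding to the common length 2b lets one index set serve all L-systems of size at most `b`.
  decodeFin-complete : ∀ {b i j} w → size ≤ b → LSystem.d G < i → LSystem.n G < j →
                       All (_≤ 1) w → Generates G w →
                       ∃ λ x → decodeFin (suc b) (b + b) i j x ≡ w
  decodeFin-complete {b} {i} {j} w s≤b d< n< bin (refl , _) = x , trans x≡ (decode-rows pad bin)
    where
    F = sum (tabulate (λ a → length (φ a)))
    l₀ = length axiom + suc (F + (σ + σ))
    pad = replicate (b + b ∸ l₀) 0
    bound : l₀ ≤ b + b
    bound = begin
      length axiom + suc (F + (σ + σ)) ≤⟨ m≤m+n _ _ ⟩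
      length axiom + suc (F + (σ + σ)) + (F + length axiom + 3) ≡⟨ ring₁ (length axiom) F σ ⟩
      size + size ≤⟨ +-mono-≤ s≤b s≤b ⟩
      b + b ∎
      where
      open ≤-Reasoning
      ring₁ : ∀ a f s → a + suc (f + (s + s)) + (f + a + 3) ≡ (f + a + s + 2) + (f + a + s + 2)
      ring₁ = solve-∀
    len : length (join rows pad) ≡ b + b
    len = begin
      length (join rows pad)                                       ≡⟨ length-rows pad ⟩
      length axiom + suc (F + (σ + σ) + length pad)    ≡⟨ sym (+-assoc (length axiom) _ (length pad)) ⟩
      l₀ + length pad                                                   ≡⟨ cong (l₀ +_) (length-replicate (b + b ∸ l₀)) ⟩
      l₀ + (b + b ∸ l₀)                                            ≡⟨ m+[n∸m]≡n bound ⟩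
      b + b ∎
      where open ≡-Reasoning
    sur = decodeFin-surjective (suc b) (b + b) i j (join rows pad) (LSystem.d G) (LSystem.n G) len
            (All-join rows pad (rows-bound s≤b) (s≤s z≤n) (All.replicate⁺ _ (s≤s z≤n))) d< n<
    x  = proj₁ sur
    x≡ = proj₂ sur

-- Pigeonhole principle and digit expansions.

-- If every `g i` were hit, choosing preimages would inject the larger set into the smaller. Being
-- hit is decidable by finite search, so a missed index can be extracted.
exists-missed : ∀ {m n} (f : Fin m → Str) (g : Fin n → Str) → (∀ i j → g i ≡ g j → i ≡ j) →
                m < n → ∃ λ i → ∀ x → f x ≢ g i
exists-missed {m} {n} f g g-inj m<n
  with Fin.¬∀⟶∃¬ n (λ i → ∃ λ x → f x ≡ g i) (λ i → Fin.any? (λ x → ≡-dec _≟_ (f x) (g i))) not-all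
  where
  not-all : ¬ (∀ i → ∃ λ x → f x ≡ g i)
  not-all h with Fin.pigeonhole m<n (proj₁ ∘ h)
  ... | i , j , i<j , eq =
    Fin.<⇒≢ i<j (g-inj i j (trans (sym (proj₂ (h i))) (trans (cong f eq) (proj₂ (h j)))))
... | i , ¬hit = i , λ x eq → ¬hit (x , eq)

tabulate-injective : ∀ {A : Set} {n} {f g : Fin n → A} → tabulate f ≡ tabulate g → ∀ i → f i ≡ g i
tabulate-injective eq zero    = ∷-injectiveˡ eq
tabulate-injective eq (suc i) = tabulate-injective (∷-injectiveʳ eq) i

funToFin-cong : ∀ {m n} {f g : Fin m → Fin n} → (∀ i → f i ≡ g i) → funToFin f ≡ funToFin g
funToFin-cong {zero}  eq = refl
funToFin-cong {suc m} eq = cong₂ combine (eq zero) (funToFin-cong (eq ∘ suc))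

digits : ∀ k n → Fin (k ^ n) → List ℕ
digits k n i = tabulate (toℕ ∘ finToFun {k} {n} i)

digits-injective : ∀ k n i j → digits k n i ≡ digits k n j → i ≡ j
digits-injective k n i j eq = begin
  i                             ≡⟨ sym (Fin.funToFin-finToFin {n} {k} i) ⟩
  funToFin (finToFun {k} {n} i) ≡⟨ funToFin-cong (λ x → Fin.toℕ-injective (tabulate-injective eq x)) ⟩
  funToFin (finToFun {k} {n} j) ≡⟨ Fin.funToFin-finToFin {n} {k} j ⟩
  j                             ∎
  where open ≡-Reasoning

digits< : ∀ k n i → All (_< k) (digits k n i)
digits< k n i = All.tabulate⁺ (λ x → Fin.toℕ<n (finToFun {k} {n} i x))

n<2^n : ∀ n → n < 2 ^ n
n<2^n zero    = s≤s z≤n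
n<2^n (suc n) = begin-strict
  suc n         ≤⟨ n<2^n n ⟩
  2 ^ n         <⟨ m<m+n (2 ^ n) (m^n>0 2 n) ⟩
  2 ^ n + 2 ^ n ≡⟨ cong (2 ^ n +_) (sym (+-identityʳ (2 ^ n))) ⟩
  2 ^ suc n     ∎
  where open ≤-Reasoning

m<[1+m/n]*n : ∀ m n .{{_ : NonZero n}} → m < suc (m / n) * n
m<[1+m/n]*n m n = begin-strict
  m                   ≡⟨ m≡m%n+[m/n]*n m n ⟩
  m % n + m / n * n   <⟨ +-monoˡ-< (m / n * n) (m%n<n m n) ⟩
  n + m / n * n       ∎
  where open ≤-Reasoning

-- Counting codes against candidates.

-- With p = 4q, the p² bits needed to name a candidate make four portions of q p
-- bits: the token list, d and n take one each, and the last makes the inequality strict.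
module _ (e : ℕ) .{{_ : NonZero e}} (q p : ℕ) (p≡2^e : p ≡ 2 ^ e) (p≡4q : p ≡ 4 * q) where

  private instance
    scale≢0 : NonZero (16 * e)
    scale≢0 = m*n≢0 16 e

  -- Here `e` is log p. The 2b tokens of at most 2e bits take 4eb bits, and the factor 16 makes this
  -- at most p²/4 = qp.
  sizeBound : ℕ
  sizeBound = p * p / (16 * e)

  private b = sizeBound

  codes : ℕ
  codes = suc b ^ (b + b) * (2 ^ (q * p) * 2 ^ (q * p))

  p>0 : 0 < p
  p>0 = subst (0 <_) (sym p≡2^e) (m^n>0 2 e)

  -- A token takes at most 2e bits, since b < p² = 2^(2e).
  suc-sizeBound≤ : suc b ≤ 2 ^ (e + e)
  suc-sizeBound≤ = begin
    suc b            ≤⟨ m/n<m (p * p) (16 * e) {{>-nonZero (*-mono-≤ p>0 p>0)}}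
                          (*-mono-≤ {2} {16} (s≤s (s≤s z≤n)) (>-nonZero⁻¹ e)) ⟩
    p * p            ≡⟨ cong₂ _*_ p≡2^e p≡2^e ⟩
    2 ^ e * 2 ^ e    ≡⟨ sym (^-distribˡ-+-* 2 e e) ⟩
    2 ^ (e + e)      ∎
    where open ≤-Reasoning

  exponent≤ : (e + e) * (b + b) ≤ q * p
  exponent≤ = *-cancelˡ-≤ 4 (begin
    4 * ((e + e) * (b + b)) ≡⟨ ring₁ e b ⟩
    b * (16 * e)            ≤⟨ m/n*n≤m (p * p) (16 * e) ⟩
    p * p                   ≡⟨ cong (_* p) p≡4q ⟩
    4 * q * p               ≡⟨ *-assoc 4 q p ⟩
    4 * (q * p)             ∎)
    where
    open ≤-Reasoning
    ring₁ : ∀ e b → 4 * ((e + e) * (b + b)) ≡ b * (16 * e)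
    ring₁ = solve-∀

  q>0 : 0 < q
  q>0 = n≢0⇒n>0 λ q≡0 → n≮n 0 (subst (0 <_) (trans p≡4q (cong (4 *_) q≡0)) p>0)

  codes< : codes < (2 ^ p) ^ p
  codes< = begin-strict
    suc b ^ (b + b) * (X * X)             ≤⟨ *-monoˡ-≤ (X * X) (^-monoˡ-≤ (b + b) suc-sizeBound≤) ⟩
    (2 ^ (e + e)) ^ (b + b) * (X * X)     ≡⟨ cong (_* (X * X)) (^-*-assoc 2 (e + e) (b + b)) ⟩
    2 ^ ((e + e) * (b + b)) * (X * X)     ≤⟨ *-monoˡ-≤ (X * X) (^-monoʳ-≤ 2 exponent≤) ⟩
    X * (X * X)                           ≡⟨ cong (X *_) (sym (^-distribˡ-+-* 2 (q * p) (q * p))) ⟩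
    X * 2 ^ (q * p + q * p)               ≡⟨ sym (^-distribˡ-+-* 2 (q * p) _) ⟩
    2 ^ (q * p + (q * p + q * p))         <⟨ ^-monoʳ-< 2 (s≤s (s≤s z≤n)) 3qp< ⟩
    2 ^ (p * p)                           ≡⟨ sym (^-*-assoc 2 p p) ⟩
    (2 ^ p) ^ p                           ∎
    where
    open ≤-Reasoning
    X = 2 ^ (q * p)
    ring₁ : ∀ x → x + (x + (x + x)) ≡ 4 * x
    ring₁ = solve-∀
    3qp< : q * p + (q * p + q * p) < p * p
    3qp< = begin-strict
      q * p + (q * p + q * p)             <⟨ +-monoʳ-< (q * p) (+-monoʳ-< (q * p) (m<m+n (q * p) (*-mono-≤ q>0 p>0))) ⟩
      q * p + (q * p + (q * p + q * p))   ≡⟨ ring₁ (q * p) ⟩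
      4 * (q * p)                         ≡⟨ sym (*-assoc 4 q p) ⟩
      4 * q * p                           ≡⟨ cong (_* p) (sym p≡4q) ⟩
      p * p                               ∎

  candidate : Fin ((2 ^ p) ^ p) → Str
  candidate i = word p (digits (2 ^ p) p i)

  candidate-injective : ∀ i j → candidate i ≡ candidate j → i ≡ j
  candidate-injective i j eq = digits-injective (2 ^ p) p i j (word-injective p (digits (2 ^ p) p i) (digits (2 ^ p) p j) eq)

  outputs : Fin codes → Str
  outputs = decodeFin (suc b) (b + b) (2 ^ (q * p)) (2 ^ (q * p))

  -- Hardness means having no code and does not mention the exponent `c`, so one family serves all
  -- exponents.
  Hard : Str → Set
  Hard w = ∃ λ i → candidate i ≡ w × (∀ x → outputs x ≢ w)

  hard-exists : ∃ λ w → Hard w × 2 ^ p ≤ length w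
  hard-exists = candidate i , (i , refl , proj₂ missed) , length-word≥ p (digits (2 ^ p) p i)
    where
    missed = exists-missed outputs candidate candidate-injective codes<
    i = proj₁ missed

  length-candidate≤ : ∀ i → length (candidate i) ≤ 2 ^ (p + p)
  length-candidate≤ i = begin
    length (candidate i)      ≤⟨ length-word≤ p ks (digits< (2 ^ p) p i) ⟩
    suc (length ks) * 2 ^ p   ≡⟨ cong (λ n → suc n * 2 ^ p) (length-tabulate {n = p} _) ⟩
    suc p * 2 ^ p             ≤⟨ *-monoˡ-≤ (2 ^ p) (n<2^n p) ⟩
    2 ^ p * 2 ^ p             ≡⟨ sym (^-distribˡ-+-* 2 p p) ⟩
    2 ^ (p + p)               ∎
    where
    open ≤-Reasoning
    ks = digits (2 ^ p) p i

  zₑ-candidate≤ : ∀ i → zₑ (candidate i) ≤ 1 + (p + 2 * p)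
  zₑ-candidate≤ i = subst (λ n → zₑ (candidate i) ≤ 1 + (p + 2 * n)) (length-tabulate {n = p} _)
    (zₑ-word p (digits (2 ^ p) p i) (All.map <⇒≤ (digits< (2 ^ p) p i)))

  -- Since n ≤ 2^(2p), the bound n^c on the depth fits into its portion of qp bits.
  length^c< : ∀ c → 2 * c < q → (2 ^ (p + p)) ^ c < 2 ^ (q * p)
  length^c< c 2c<q = begin-strict
    (2 ^ (p + p)) ^ c   ≡⟨ ^-*-assoc 2 (p + p) c ⟩
    2 ^ ((p + p) * c)   <⟨ ^-monoʳ-< 2 (s≤s (s≤s z≤n)) lt ⟩
    2 ^ (q * p)         ∎
    where
    open ≤-Reasoning
    ring₁ : ∀ p c → (p + p) * c ≡ 2 * c * p
    ring₁ = solve-∀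
    lt : (p + p) * c < q * p
    lt = subst (_< q * p) (sym (ring₁ p c)) (*-monoˡ-< p {{>-nonZero p>0}} 2c<q)

  -- If m ≤ b, the L-system attaining `m` would have a code, which a hard word does not.
  hard⇒sizeBound< : ∀ c w → 2 * c < q → 2 < q → Hard w → ∀ m → Isℓ c w m → b < m
  hard⇒sizeBound< c w 2c<q 2<q (i , refl , miss) m record { attained = G , (d≤ , _) , gen , refl } =
    ≰⇒> λ s≤b → let x , x≡ = decodeFin-complete G w s≤b d< n< (binary-word p (digits (2 ^ p) p i)) gen in miss x x≡
    where
    n≤ : LSystem.n G ≤ 2 ^ (p + p)
    n≤ = subst (_≤ 2 ^ (p + p)) (proj₂ gen) (length-candidate≤ i)
    d< : LSystem.d G < 2 ^ (q * p)
    d< = ≤-<-trans (≤-trans d≤ (^-monoˡ-≤ c n≤)) (length^c< c 2c<q)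
    n< : LSystem.n G < 2 ^ (q * p)
    -- The case c = 1 of `length^c<`, whence the hypothesis `2 < q`.
    n< = ≤-<-trans n≤ (subst (_< 2 ^ (q * p)) (^-identityʳ (2 ^ (p + p))) (length^c< 1 2<q))

  -- The bounds 4p on the phrase count and 2p on log n give 8p², while p² < 16e(b + 1) ≤ 16em and e
  -- = log p ≤ log log n. Hence 128 = 8 · 16.
  hard-bound : ∀ w m → Hard w → b < m →
               zₑ w * ⌊log₂ length w ⌋ ≤ 128 * (m * ⌊log₂ ⌊log₂ length w ⌋ ⌋)
  hard-bound w m (i , refl , _) b<m = begin
    zₑ w * ⌊log₂ length w ⌋                 ≤⟨ *-mono-≤ (zₑ-candidate≤ i) log≤ ⟩
    (1 + (p + 2 * p)) * (p + p)             ≤⟨ *-monoˡ-≤ (p + p) (+-monoˡ-≤ (p + 2 * p) p>0) ⟩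
    (p + (p + 2 * p)) * (p + p)             ≡⟨ ring₁ p ⟩
    8 * (p * p)                             ≤⟨ *-monoʳ-≤ 8 (<⇒≤ (m<[1+m/n]*n (p * p) (16 * e))) ⟩
    8 * (suc b * (16 * e))                  ≤⟨ *-monoʳ-≤ 8 (*-monoˡ-≤ (16 * e) b<m) ⟩
    8 * (m * (16 * e))                      ≡⟨ ring₂ m e ⟩
    128 * (m * e)                           ≤⟨ *-monoʳ-≤ 128 (*-monoʳ-≤ m e≤) ⟩
    128 * (m * ⌊log₂ ⌊log₂ length w ⌋ ⌋)    ∎
    where
    open ≤-Reasoning
    ring₁ : ∀ p → (p + (p + 2 * p)) * (p + p) ≡ 8 * (p * p)
    ring₁ = solve-∀
    ring₂ : ∀ m e → 8 * (m * (16 * e)) ≡ 128 * (m * e)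
    ring₂ = solve-∀
    log≤ : ⌊log₂ length w ⌋ ≤ p + p
    log≤ = subst (⌊log₂ length w ⌋ ≤_) (⌊log₂[2^n]⌋≡n (p + p)) (⌊log₂⌋-mono-≤ (length-candidate≤ i))
    p≤ : p ≤ ⌊log₂ length w ⌋
    p≤ = subst (_≤ ⌊log₂ length w ⌋) (⌊log₂[2^n]⌋≡n p) (⌊log₂⌋-mono-≤ (length-word≥ p (digits (2 ^ p) p i)))
    e≤ : e ≤ ⌊log₂ ⌊log₂ length w ⌋ ⌋
    e≤ = subst (_≤ ⌊log₂ ⌊log₂ length w ⌋ ⌋) (trans (cong ⌊log₂_⌋ p≡2^e) (⌊log₂[2^n]⌋≡n e))
           (⌊log₂⌋-mono-≤ p≤)

  -- As n ≤ 2^(2p) = 2^(8q), a long word forces a large `q`.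
  long⇒q> : ∀ t w → Hard w → 2 ^ (8 * t) < length w → t < q
  long⇒q> t w (i , refl , _) long = ≰⇒> λ q≤t → <⇒≱ long (begin
    length w       ≤⟨ length-candidate≤ i ⟩
    2 ^ (p + p)    ≡⟨ cong (λ x → 2 ^ (x + x)) p≡4q ⟩
    2 ^ (4 * q + 4 * q) ≡⟨ cong (2 ^_) (sym (*-distribʳ-+ q 4 4)) ⟩
    2 ^ (8 * q)    ≤⟨ ^-monoʳ-≤ 2 (*-monoʳ-≤ 8 q≤t) ⟩
    2 ^ (8 * t)    ∎)
    where open ≤-Reasoning

-- The family of hard words.

4*2^k : ∀ k → 2 ^ (2 + k) ≡ 4 * 2 ^ k
4*2^k k = sym (*-assoc 2 2 (2 ^ k))

lemma3 : ∃ λ (F : Pred Str 0ℓ) →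
    Unbounded F ×
    (∀ (c : ℕ) → ∃ λ (K : ℕ) → ∃ λ (N : ℕ) →
    ∀ w → w ∈ F → N ≤ length w →
    ∀ m → Isℓ c w m →
    zₑ w * ⌊log₂ length w ⌋ ≤ K * (m * ⌊log₂ ⌊log₂ length w ⌋ ⌋))
-- The threshold gives q > 2c + 2, which covers both 2c < q and 2 < q; the constant 128 is the same
-- for all `c`.
lemma3 = F , unbounded , λ c → 128 , suc (2 ^ (8 * (2 * c + 2))) , bound c
  where
  F : Pred Str 0ℓ
  -- The exponent is at least 2, so that 4 divides p.
  F w = ∃ λ k → Hard (2 + k) (2 ^ k) (2 ^ (2 + k)) refl (4*2^k k) w
  unbounded : Unbounded F
  unbounded k = w , (k , proj₁ (proj₂ hard)) , (begin
    k                   ≤⟨ m≤n+m k 2 ⟩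
    2 + k               ≤⟨ <⇒≤ (n<2^n (2 + k)) ⟩
    2 ^ (2 + k)         ≤⟨ <⇒≤ (n<2^n (2 ^ (2 + k))) ⟩
    2 ^ 2 ^ (2 + k)     ≤⟨ proj₂ (proj₂ hard) ⟩
    length w            ∎)
    where
    open ≤-Reasoning
    hard = hard-exists (2 + k) (2 ^ k) (2 ^ (2 + k)) refl (4*2^k k)
    w = proj₁ hard
  bound : ∀ c w → w ∈ F → suc (2 ^ (8 * (2 * c + 2))) ≤ length w → ∀ m → Isℓ c w m →
          zₑ w * ⌊log₂ length w ⌋ ≤ 128 * (m * ⌊log₂ ⌊log₂ length w ⌋ ⌋)
  bound c w (k , hard) long m isℓ =
    hard-bound (2 + k) (2 ^ k) (2 ^ (2 + k)) refl (4*2^k k) w m hard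
      (hard⇒sizeBound< (2 + k) (2 ^ k) (2 ^ (2 + k)) refl (4*2^k k) c w
        (≤-<-trans (m≤m+n (2 * c) 2) q>) (≤-<-trans (m≤n+m 2 (2 * c)) q>) hard m isℓ)
    where
    q> : 2 * c + 2 < 2 ^ k
    q> = long⇒q> (2 + k) (2 ^ k) (2 ^ (2 + k)) refl (4*2^k k) (2 * c + 2) w hard long
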